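{- There are absolute constants $C>0$ and $n_0$ such that for all integers $n\ge n_0$, $$\chi_3(n,n)\ \ge\ \log\log n-C\log\log\log n .$$
   Context: $[n]=\{1,\dots,n\}$; $\log$ is base 2. A line in $[n]^3$ is a set obtained by fixing two of the three coordinates and letting the remaining one vary over $[n]$. A 2-dimensional permutation of order $n$ is a function $f:[n]^3\to\{0,1\}$ such that every line contains exactly one point where $f=1$. A cylinder in dimension $i$ is a subset of $[n]^3$ closed under arbitrary changes of the $i$-th coordinate, and a cylinder intersection is a set $T_1\cap T_2\cap T_3$ with $T_i$ a cylinder in dimension $i$. $\chi_3(f)$ is the least number of cylinder intersections, each contained in $f^{ -1}(1)$, whose union is $f^{ -1}(1)$. $\chi_3(n,n)=\min_f\chi_3(f)$ over all 2-dimensional permutations $f:[n]^3\to\{0,1\}$. -}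

module Defs where

open import Data.Bool.Base using (Bool; true; _∧_)
open import Data.Fin.Base using (Fin; zero; suc)
open import Data.Integer.Base as ℤ using (ℤ)
open import Data.Nat.Base as ℕ using (ℕ)
open import Data.Product.Base using (Σ; ∃; ∃₂; ∃-syntax; _×_; _,_)
open import Data.Product using (∃!)
open import Data.Rational.Base using
  (ℚ; _<_; _-_; _*_; _/_; 0ℚ; ½; ↥_; ↧ₙ_; +-*-rawSemiring)
open import Data.Sum.Base using (_⊎_)
open import Data.Vec.Base using (Vec; _[_]≔_)
open import Relation.Binary.PropositionalEquality.Core using (_≡_)
open import Relation.Nullary.Negation.Core using (¬_)

open import Algebra.Definitions.RawSemiring +-*-rawSemiring using (_^_)

------------------------------------------------------------------------
-- Real numbers as Dedekind cuts

-- `lower x q` is read q < x and `upper x q` is read x < q.  The operations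
-- below make sense for every pair of predicates; `IsReal` singles out the
-- pairs that are Dedekind real numbers.

record Cut : Set₁ where
  field
    lower : ℚ → Set
    upper : ℚ → Set

open Cut public

record IsReal (x : Cut) : Set where
  field
    lower-inhabited : ∃ (lower x)
    upper-inhabited : ∃ (upper x)
    lower-open      : ∀ {q} → lower x q → ∃[ r ] q < r × lower x r
    lower-closed    : ∀ {q r} → q < r → lower x r → lower x q
    upper-open      : ∀ {r} → upper x r → ∃[ q ] q < r × upper x q
    upper-closed    : ∀ {q r} → q < r → upper x q → upper x r
    disjoint        : ∀ {q} → ¬ (lower x q × upper x q)
    located         : ∀ {q r} → q < r → lower x q ⊎ upper x r

infix  4 _≤ᶜ_ _<ᶜ_ _≥ᶜ_
infixl 6 _-ᶜ_
infixl 7 _*ᶜ_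

_≤ᶜ_ : Cut → Cut → Set
x ≤ᶜ y = ∀ q → lower x q → lower y q

_≥ᶜ_ : Cut → Cut → Set
x ≥ᶜ y = y ≤ᶜ x

_<ᶜ_ : Cut → Cut → Set
x <ᶜ y = ∃[ q ] upper x q × lower y q

fromℚ : ℚ → Cut
fromℚ p = record { lower = λ q → q < p ; upper = λ q → p < q }

fromℕ : ℕ → Cut
fromℕ n = fromℚ (ℤ.+ n / 1)

_-ᶜ_ : Cut → Cut → Cut
x -ᶜ y = record
  { lower = λ q → ∃₂ λ a b → lower x a × upper y b × q < a - b
  ; upper = λ q → ∃₂ λ a b → upper x a × lower y b × a - b < q
  }

-- Interval multiplication: if a < x < b and c < y < d, then x * y lies
-- strictly between the least and the greatest of ac, ad, bc, bd.

_*ᶜ_ : Cut → Cut → Cut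
x *ᶜ y = record
  { lower = λ q → ∃₂ λ a b → ∃₂ λ c d →
      (lower x a × upper x b × lower y c × upper y d) ×
      (q < a * c × q < a * d × q < b * c × q < b * d)
  ; upper = λ q → ∃₂ λ a b → ∃₂ λ c d →
      (lower x a × upper x b × lower y c × upper y d) ×
      (a * c < q × a * d < q × b * c < q × b * d < q)
  }

2^_ : ℤ → ℚ
2^ (ℤ.+ n)    = (ℤ.+ 2 / 1) ^ n
2^ ℤ.-[1+ n ] = ½ ^ ℕ.suc n

-- For q = a/b with b > 0 and a rational r > 0, q < log₂ r iff 2^a < r^b.
-- As for any logarithm, the argument is meant to be positive.

log₂ : Cut → Cut
log₂ x = record
  { lower = λ q → ∃[ r ] 0ℚ < r × lower x r × 2^ (↥ q) < r ^ (↧ₙ q)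
  ; upper = λ q → ∃[ r ] 0ℚ < r × upper x r × r ^ (↧ₙ q) < 2^ (↥ q)
  }

------------------------------------------------------------------------
-- Permutations and cylinder intersections

Point : ℕ → Set
Point n = Vec (Fin n) 3

-- A 0/1-valued function on [n]³, also used for the subset where it is true.

Cube : ℕ → Set
Cube n = Point n → Bool

_⊆_ : ∀ {n} → Cube n → Cube n → Set
S ⊆ T = ∀ x → S x ≡ true → T x ≡ true

-- The points x [ i ]≔ a, for a varying over [n], form the line through x in
-- direction i.

IsPermutation : ∀ {n} → Cube n → Set
IsPermutation f = ∀ i x → ∃! _≡_ λ a → f (x [ i ]≔ a) ≡ true

IsCylinder : ∀ {n} → Fin 3 → Cube n → Set
IsCylinder i T = ∀ x a → T x ≡ true → T (x [ i ]≔ a) ≡ true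

IsCylinderIntersection : ∀ {n} → Cube n → Set
IsCylinderIntersection {n} S = Σ (Fin 3 → Cube n) λ T →
  (∀ i → IsCylinder i (T i)) ×
  (∀ x → S x ≡ T zero x ∧ T (suc zero) x ∧ T (suc (suc zero)) x)

IsCoveredBy : ∀ {n} → Cube n → ℕ → Set
IsCoveredBy {n} f k = Σ (Fin k → Cube n) λ S →
  (∀ j → IsCylinderIntersection (S j)) ×
  (∀ j → S j ⊆ f) ×
  (∀ x → f x ≡ true → ∃[ j ] S j x ≡ true)

IsLeast : (ℕ → Set) → ℕ → Set
IsLeast P k = P k × (∀ m → P m → k ℕ.≤ m)

-- The minima χ₃(f) and χ₃(n,n) are given by their graphs: χ₃ f k says that
-- χ₃(f) = k, and χ₃-min n k says that χ₃(n,n) = k.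

χ₃ : ∀ {n} → Cube n → ℕ → Set
χ₃ f = IsLeast (IsCoveredBy f)

χ₃-min : ℕ → ℕ → Set
χ₃-min n = IsLeast λ k → Σ (Cube n) λ f → IsPermutation f × χ₃ f k

{-# OPTIONS --safe #-}

-- The points of f⁻¹(1) form a Latin square, and a cover by k cylinder
-- intersections colours its cells with k colours.  A cylinder intersection
-- contains the centre of every star whose tips it contains, so if two
-- distinct cells (x , y) and (x′ , y′) carry the same symbol and the same colour,
-- then the cell (x , y′) has another colour.
--
-- Suppose the cells of X × Y use at most r colours, where X and Y have at least
-- n / d elements.  By pigeonhole n / (k d²) of these cells share symbol and colour.
-- The rows of one half of them and the columns of the other half span a grid that
-- avoids this colour.  So r drops by one and d becomes 4 k d², that is, 4 k d is
-- squared; starting from d = 1 and r = k this gives n ≤ (4k)^(2^k), i.e.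
-- log log n ≤ k + log log (4k), and one may assume k < log log n.  The
-- cuts enter only through the integer parts of the approximations to the iterated
-- logarithms, at the cost of a constant that the factor 3 of log log log n absorbs.

module Submission where

open import Data.Bool.Base using (true; _∧_)
open import Data.Bool.Properties using (∧-conicalˡ; ∧-conicalʳ)
open import Data.Fin.Base as Fin using (Fin; zero; suc)
open import Data.Fin.Properties as Fin using (combine-injective)
open import Data.List.Base using
  (List; []; _∷_; _++_; length; map; filter; take; drop; allFin; cartesianProduct)
open import Data.List.Membership.Propositional using (_∈_)
open import Data.List.Membership.Propositional.Properties using
  (∈-allFin; ∈-filter⁺; ∈-filter⁻; ∈-map⁻; ∈-++⁺ˡ; ∈-++⁺ʳ; ∈-cartesianProduct⁻)
open import Data.List.Properties using
  (filter-notAll; length-++; length-drop; length-map; length-tabulate;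
   length-take; take++drop≡id)
open import Data.List.Relation.Binary.Sublist.Propositional.Properties using
  (filter-⊆; length-mono-≤) renaming (filter⁺ to ⊆-filter⁺)
open import Data.List.Relation.Unary.All as All using (All; []; _∷_)
import Data.List.Relation.Unary.All.Properties as All
open import Data.List.Relation.Unary.AllPairs using ([]; _∷_)
open import Data.List.Relation.Unary.Any as Any using (here; there)
open import Data.List.Relation.Unary.Unique.Propositional using (Unique)
import Data.List.Relation.Unary.Unique.Propositional.Properties as Unique
open import Data.Integer.Base as ℤ using (ℤ)
import Data.Integer.Properties as ℤ
import Data.Nat.Base as ℕ
import Data.Nat.Coprimality as Coprime
open import Data.Nat.DivMod using (m/n*n≤m; m≡m%n+[m/n]*n; m%n<n)
open import Data.Nat.Base using
  (ℕ; zero; suc; _+_; _*_; _^_; _∸_; _≤_; _<_; z≤n; s≤s; s≤s⁻¹; z<s;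
   NonZero; >-nonZero; ⌊_/2⌋)
open import Data.Nat.Properties
open import Data.Nat.Solver using (module +-*-Solver)
open import Data.Product.Base using (∃; ∃₂; ∃-syntax; _×_; _,_; proj₁; proj₂; uncurry)
open import Data.Rational.Base as ℚ using
  (ℚ; mkℚ; 0ℚ; 1ℚ; ½; ↥_; ↧_; ↧ₙ_; _/_; +-*-rawSemiring)
import Data.Rational.Properties as ℚ
open import Data.Sum.Base using (_⊎_; inj₁; inj₂)
open import Data.Vec.Base using (_[_]≔_) renaming ([] to []ᵥ; _∷_ to _∷ᵥ_)
open import Function.Base using (_∘_; case_of_)
open import Relation.Binary.PropositionalEquality
open import Relation.Binary.Definitions using (DecidableEquality)
open import Relation.Nullary using (¬_; Dec; yes; no; ¬?; contradiction)
open import Algebra.Definitions.RawSemiring +-*-rawSemiring using () renaming (_^_ to _ℚ^_)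
open import Defs

private
  variable
    A B : Set

-- Finite lists: pigeonhole and freedom from repetition.

length-filter-¬? : ∀ {P : A → Set} (P? : ∀ x → Dec (P x)) xs →
  length xs ≡ length (filter P? xs) + length (filter (¬? ∘ P?) xs)
length-filter-¬? P? [] = refl
length-filter-¬? P? (x ∷ xs) with P? x
... | yes _ = cong suc (length-filter-¬? P? xs)
... | no  _ = trans (cong suc (length-filter-¬? P? xs)) (sym (+-suc _ _))

length-cartesianProduct : ∀ (xs : List A) (ys : List B) →
  length (cartesianProduct xs ys) ≡ length xs * length ys
length-cartesianProduct []       ys = refl
length-cartesianProduct (x ∷ xs) ys = trans (length-++ (map (x ,_) ys))
  (cong₂ _+_ (length-map (x ,_) ys) (length-cartesianProduct xs ys))

module _ (_≟_ : DecidableEquality B) (g : A → B) where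

  fibre : B → List A → List A
  fibre w = filter (λ x → g x ≟ w)

  -- Induction on `ws`: remove the fibre over `w`, apply the induction hypothesis to the rest, and
  -- keep the larger of the two fibres. The recursion needs a nonempty list, so an empty rest is
  -- treated separately, with `w` as witness.
  pigeonhole : ∀ ws xs → 0 < length xs → (∀ {x} → x ∈ xs → g x ∈ ws) →
    ∃[ w ] length xs ≤ length ws * length (fibre w xs)
  pigeonhole [] (x ∷ xs) _ g∈ with () ← g∈ (here refl)
  pigeonhole (w ∷ ws) xs 0<xs g∈ = split
    where
    rest : List A
    rest = filter (λ x → ¬? (g x ≟ w)) xs

    length-xs : length xs ≡ length (fibre w xs) + length rest
    length-xs = length-filter-¬? (λ x → g x ≟ w) xs

    g∈ws : ∀ {x} → x ∈ rest → g x ∈ ws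
    g∈ws x∈ with ∈-filter⁻ (λ x → ¬? (g x ≟ w)) x∈
    ... | x∈xs , gx≢w with g∈ x∈xs
    ...   | here gx≡w = contradiction gx≡w gx≢w
    ...   | there gx∈ = gx∈

    fibre-rest : ∀ v → length (fibre v rest) ≤ length (fibre v xs)
    fibre-rest v = length-mono-≤
      (⊆-filter⁺ (λ x → g x ≟ v) (λ x → g x ≟ v) (λ { refl eq → eq }) (filter-⊆ (λ x → ¬? (g x ≟ w)) xs))

    split : ∃[ v ] length xs ≤ suc (length ws) * length (fibre v xs)
    split with 0 <? length rest
    ... | no  0≮rest = w , (begin
      length xs                           ≡⟨ length-xs ⟩
      length (fibre w xs) + length rest   ≤⟨ +-monoʳ-≤ (length (fibre w xs)) (≤-trans (≮⇒≥ 0≮rest) z≤n) ⟩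
      suc (length ws) * length (fibre w xs) ∎)
      where open ≤-Reasoning
    ... | yes 0<rest with pigeonhole ws rest 0<rest g∈ws
    ...   | v , rest≤ with ≤-total (length (fibre w xs)) (length (fibre v xs))
    ...     | inj₁ w≤v = v , (begin
      length xs                         ≡⟨ length-xs ⟩
      length (fibre w xs) + length rest ≤⟨ +-mono-≤ w≤v (≤-trans rest≤ (*-monoʳ-≤ (length ws) (fibre-rest v))) ⟩
      suc (length ws) * length (fibre v xs) ∎)
      where open ≤-Reasoning
    ...     | inj₂ v≤w = w , (begin
      length xs                         ≡⟨ length-xs ⟩
      length (fibre w xs) + length rest ≤⟨ +-monoʳ-≤ (length (fibre w xs))
                                            (≤-trans rest≤ (*-monoʳ-≤ (length ws) (≤-trans (fibre-rest v) v≤w))) ⟩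
      suc (length ws) * length (fibre w xs) ∎)
      where open ≤-Reasoning

-- Injectivity is asked only on members of the list, because a coordinate projection is injective on
-- cells that share a symbol but not on all cells.
Unique-map⁺ : ∀ (f : A → B) {xs} → (∀ {x y} → x ∈ xs → y ∈ xs → f x ≡ f y → x ≡ y) →
  Unique xs → Unique (map f xs)
Unique-map⁺ f inj []          = []
Unique-map⁺ f inj (x∉ ∷ xs!) =
  All.map⁺ (All.tabulate λ y∈ fx≡fy → All.lookup x∉ y∈ (inj (here refl) (there y∈) fx≡fy)) ∷
  Unique-map⁺ f (λ x∈ y∈ → inj (there x∈) (there y∈)) xs!

Unique-++⁻-disjoint : ∀ (xs {ys} : List A) → Unique (xs ++ ys) → ∀ {x y} → x ∈ xs → y ∈ ys → x ≢ y
Unique-++⁻-disjoint (_ ∷ xs) (x∉ ∷ _)  (here refl) y∈ = All.lookup x∉ (∈-++⁺ʳ xs y∈)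
Unique-++⁻-disjoint (_ ∷ xs) (_ ∷ xs!) (there x∈)  y∈ = Unique-++⁻-disjoint xs xs! x∈ y∈

-- Arithmetic of powers, halves and densities.

m≤m^n : ∀ m n .{{_ : NonZero n}} → m ≤ m ^ n
m≤m^n zero      _       = z≤n
m≤m^n m@(suc _) (suc n) = m≤m*n m (m ^ n) {{m^n≢0 m n}}

m≤m*m : ∀ m → m ≤ m * m
m≤m*m zero      = z≤n
m≤m*m m@(suc _) = m≤m*n m m

-- This is the source of the 4 in `4 * k`. A power of two is convenient because `4 * 2 ^ k` later
-- becomes `2 ^ (2 + k)`.
n≤4*⌊n/2⌋ : ∀ {n} → 1 < n → n ≤ 4 * ⌊ n /2⌋
n≤4*⌊n/2⌋ {suc zero}                (s≤s ())
n≤4*⌊n/2⌋ {suc (suc zero)}          _ = s≤s (s≤s z≤n)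
n≤4*⌊n/2⌋ {suc (suc (suc zero))}    _ = s≤s (s≤s (s≤s z≤n))
n≤4*⌊n/2⌋ {suc (suc n@(suc (suc _)))} _ = begin
  2 + n             ≤⟨ +-mono-≤ {2} {4} (s≤s (s≤s z≤n)) (n≤4*⌊n/2⌋ {n} (s≤s (s≤s z≤n))) ⟩
  4 + 4 * ⌊ n /2⌋   ≡⟨ *-suc 4 ⌊ n /2⌋ ⟨
  4 * suc ⌊ n /2⌋   ∎
  where open ≤-Reasoning

⌊n/2⌋≤n∸⌊n/2⌋ : ∀ n → ⌊ n /2⌋ ≤ n ∸ ⌊ n /2⌋
⌊n/2⌋≤n∸⌊n/2⌋ n = m+n≤o⇒m≤o∸n ⌊ n /2⌋
  (subst (⌊ n /2⌋ + ⌊ n /2⌋ ≤_) (⌊n/2⌋+⌈n/2⌉≡n n) (+-monoʳ-≤ ⌊ n /2⌋ (⌊n/2⌋≤⌈n/2⌉ n)))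

-- Here `a` and `b` count rows and columns, and `f` is the size of the most popular of the `n * k`
-- classes. Multiplying the two density hypotheses and cancelling one factor `n` gives the claim.
density : ∀ n k d a b f → 0 < n → n ≤ a * d → n ≤ b * d → a * b ≤ n * k * f →
  n ≤ f * (k * (d * d))
density n k d a b f 0<n n≤ad n≤bd ab≤ = *-cancelˡ-≤ n {{>-nonZero 0<n}} (begin
  n * n                   ≤⟨ *-mono-≤ n≤ad n≤bd ⟩
  a * d * (b * d)         ≡⟨ solve 3 (λ a b d → a :* d :* (b :* d) := a :* b :* (d :* d)) refl a b d ⟩
  a * b * (d * d)         ≤⟨ *-monoˡ-≤ (d * d) ab≤ ⟩
  n * k * f * (d * d)     ≡⟨ solve 4 (λ n k f d → n :* k :* f :* (d :* d) := n :* (f :* (k :* (d :* d)))) refl n k f d ⟩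
  n * (f * (k * (d * d))) ∎)
  where
  open ≤-Reasoning
  open +-*-Solver

-- Coloured Latin squares and the density iteration.

module _ {n k : ℕ} (symbol : Fin n → Fin n → Fin n) (colour : Fin n → Fin n → Fin k)
  (row-injective    : ∀ {x y y′} → symbol x y ≡ symbol x y′ → y ≡ y′)
  (column-injective : ∀ {x x′ y} → symbol x y ≡ symbol x′ y → x ≡ x′)
  (corner-free      : ∀ {x y x′ y′} → symbol x y ≡ symbol x′ y′ →
                      colour x y ≡ colour x′ y′ → colour x y′ ≡ colour x y → y ≡ y′)
  where

  Cell : Set
  Cell = Fin n × Fin n

  Monochromatic : Fin n → Fin k → List Cell → Set
  Monochromatic z c F = ∀ {x y} → (x , y) ∈ F → symbol x y ≡ z × colour x y ≡ c

  class : Cell → Fin (n * k)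
  class (x , y) = Fin.combine (symbol x y) (colour x y)

  class≟ : ∀ z c (p : Cell) → Dec (class p ≡ Fin.combine {n} {k} z c)
  class≟ z c p = class p Fin.≟ Fin.combine {n} {k} z c

  members : Fin n → Fin k → List (Fin n) → List (Fin n) → List Cell
  members z c X Y = filter (class≟ z c) (cartesianProduct X Y)

  popular-class : ∀ X Y → 0 < length X → 0 < length Y → Unique X → Unique Y →
    ∃₂ λ z c → ∃[ F ] Unique F × Monochromatic z c F ×
      (∀ {x y} → (x , y) ∈ F → x ∈ X × y ∈ Y) ×
      length X * length Y ≤ n * k * length F
  popular-class X Y 0<X 0<Y X! Y!
    with w , len ← pigeonhole Fin._≟_ class (allFin (n * k)) (cartesianProduct X Y)
           (subst (0 <_) (sym (length-cartesianProduct X Y)) (*-mono-< 0<X 0<Y)) (λ _ → ∈-allFin _)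
    with z , c , refl ← Fin.combine-surjective {n} {k} w
    = z , c , members z c X Y
    , Unique.filter⁺ (class≟ z c) (Unique.cartesianProduct⁺ X! Y!)
    , (λ {x} {y} p∈ → combine-injective (symbol x y) (colour x y) z c
        (proj₂ (∈-filter⁻ (class≟ z c) {xs = cartesianProduct X Y} p∈)))
    , (λ p∈ → ∈-cartesianProduct⁻ X Y (proj₁ (∈-filter⁻ (class≟ z c) {xs = cartesianProduct X Y} p∈)))
    , subst₂ _≤_ (length-cartesianProduct X Y)
        (cong (_* length (members z c X Y)) (length-tabulate {n = n * k} (λ i → i))) len

  module _ {z : Fin n} {c : Fin k} where

    -- A symbol occurs only once in a row, so cells of one symbol in the same row coincide. This
    -- keeps the rows of the next grid distinct.
    rows-unique : ∀ {F} → Monochromatic z c F → Unique F → Unique (map proj₁ F)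
    rows-unique mono = Unique-map⁺ proj₁ λ { p∈ q∈ refl →
      cong (_ ,_) (row-injective (trans (proj₁ (mono p∈)) (sym (proj₁ (mono q∈))))) }

    columns-unique : ∀ {F} → Monochromatic z c F → Unique F → Unique (map proj₂ F)
    columns-unique mono = Unique-map⁺ proj₂ λ { p∈ q∈ refl →
      cong (_, _) (column-injective (trans (proj₁ (mono p∈)) (sym (proj₁ (mono q∈))))) }

    -- The cell (x , y′) is the centre of the star with tips (x , y) and (x′ , y′).
    colour-avoided : ∀ {F} → Monochromatic z c F → ∀ {x y x′ y′} →
      (x , y) ∈ F → (x′ , y′) ∈ F → (x , y) ≢ (x′ , y′) → colour x y′ ≢ c
    colour-avoided mono p∈ q∈ p≢q cxy′≡c
      with zp , cp ← mono p∈ | zq , cq ← mono q∈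
      with refl ← corner-free (trans zp (sym zq)) (trans cp (sym cq)) (trans cxy′≡c (sym cp))
      with refl ← column-injective (trans zp (sym zq))
      = p≢q refl

  -- Induction on `r`, with the threshold `(4 * k * d) ^ (2 ^ r)` as invariant: replacing `d` by
  -- `4 * k * (d * d)` squares the base, while lowering `r` by one halves the exponent `2 ^ r`.
  shrink : ∀ r d (X Y : List (Fin n)) (C : List (Fin k)) → Unique X → Unique Y →
    (∀ {x y} → x ∈ X → y ∈ Y → colour x y ∈ C) → length C ≤ r →
    n ≤ length X * d → n ≤ length Y * d → ¬ (4 * k * d) ^ (2 ^ r) < n
  -- An empty side would force `n` to be at most 0. With `r` equal to 0, a cell of a nonempty grid
  -- would have no colour left.
  shrink r d [] Y C X! Y! C∋ C≤r n≤X n≤Y n> with () ← ≤-trans n> n≤X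
  shrink r d X@(_ ∷ _) [] C X! Y! C∋ C≤r n≤X n≤Y n> with () ← ≤-trans n> n≤Y
  shrink zero d (_ ∷ _) (_ ∷ _) [] X! Y! C∋ C≤r n≤X n≤Y n> with () ← C∋ (here refl) (here refl)
  shrink (suc r) d X@(_ ∷ _) Y@(_ ∷ _) C X! Y! C∋ C≤r n≤X n≤Y n>
    with z , c , F , F! , mono , F⊆ , XY≤ ← popular-class X Y z<s z<s X! Y!
    = shrink r (4 * k * (d * d)) X′ Y′ C′
        (rows-unique mono₁ (Unique.take⁺ h F!))
        (columns-unique mono₂ (Unique.drop⁺ h F!))
        C′∋ (s≤s⁻¹ (≤-trans (filter-notAll (λ e → ¬? (e Fin.≟ c)) C c∈C) C≤r))
        (subst (λ m → n ≤ m * _) (sym length-X′) n≤h)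
        (≤-trans n≤h (*-monoˡ-≤ (4 * k * (d * d)) h≤Y′))
        (subst (λ e → e ^ (2 ^ r) < n) squared (subst (_< n) (sym (^-*-assoc (4 * k * d) 2 (2 ^ r))) n>))
    where
    open ≤-Reasoning
    open +-*-Solver using (solve; _:*_; _:^_; _:=_; con)

    f = length F
    h = ⌊ f /2⌋
    F₁ = take h F
    F₂ = drop h F
    X′ = map proj₁ F₁
    Y′ = map proj₂ F₂
    C′ = filter (λ e → ¬? (e Fin.≟ c)) C

    F₁⊆F : ∀ {p} → p ∈ F₁ → p ∈ F
    F₁⊆F p∈ = subst (_ ∈_) (take++drop≡id h F) (∈-++⁺ˡ p∈)

    F₂⊆F : ∀ {p} → p ∈ F₂ → p ∈ F
    F₂⊆F p∈ = subst (_ ∈_) (take++drop≡id h F) (∈-++⁺ʳ F₁ p∈)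

    mono₁ : Monochromatic z c F₁
    mono₁ = mono ∘ F₁⊆F

    mono₂ : Monochromatic z c F₂
    mono₂ = mono ∘ F₂⊆F

    squared : (4 * k * d) ^ 2 ≡ 4 * k * (4 * k * (d * d))
    squared = solve 2 (λ k d → (con 4 :* k :* d) :^ 2 := con 4 :* k :* (con 4 :* k :* (d :* d))) refl k d

    0<n : 0 < n
    0<n = ≤-trans (s≤s z≤n) n>

    n≤f : n ≤ f * (k * (d * d))
    n≤f = density n k d (length X) (length Y) f 0<n n≤X n≤Y XY≤

    -- The largeness of `n` excludes a class with at most one cell, whose half `h` would be 0.
    1<f : 1 < f
    1<f = ≰⇒> λ f≤1 → <⇒≱ n> (begin
      n                            ≤⟨ n≤f ⟩
      f * (k * (d * d))            ≤⟨ *-monoˡ-≤ (k * (d * d)) f≤1 ⟩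
      1 * (k * (d * d))            ≡⟨ *-identityˡ (k * (d * d)) ⟩
      k * (d * d)                  ≤⟨ *-monoˡ-≤ (d * d) (m≤m*m k) ⟩
      k * k * (d * d)              ≤⟨ m≤n*m (k * k * (d * d)) 16 ⟩
      16 * (k * k * (d * d))       ≡⟨ solve 2 (λ k d → con 16 :* (k :* k :* (d :* d)) := (con 4 :* k :* d) :^ 2) refl k d ⟩
      (4 * k * d) ^ 2              ≤⟨ m≤m^n ((4 * k * d) ^ 2) (2 ^ r) {{m^n≢0 2 r}} ⟩
      ((4 * k * d) ^ 2) ^ (2 ^ r)  ≡⟨ ^-*-assoc (4 * k * d) 2 (2 ^ r) ⟩
      (4 * k * d) ^ (2 ^ suc r)    ∎)

    n≤h : n ≤ h * (4 * k * (d * d))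
    n≤h = begin
      n                       ≤⟨ n≤f ⟩
      f * (k * (d * d))       ≤⟨ *-monoˡ-≤ (k * (d * d)) (n≤4*⌊n/2⌋ 1<f) ⟩
      4 * h * (k * (d * d))   ≡⟨ solve 3 (λ h k d → con 4 :* h :* (k :* (d :* d)) := h :* (con 4 :* k :* (d :* d))) refl h k d ⟩
      h * (4 * k * (d * d))   ∎

    length-X′ : length X′ ≡ h
    length-X′ = trans (length-map proj₁ F₁) (trans (length-take h F) (m≤n⇒m⊓n≡m (⌊n/2⌋≤n f)))

    h≤Y′ : h ≤ length Y′
    h≤Y′ = subst (h ≤_) (sym (trans (length-map proj₂ F₂) (length-drop h F))) (⌊n/2⌋≤n∸⌊n/2⌋ f)

    C′∋ : ∀ {x y} → x ∈ X′ → y ∈ Y′ → colour x y ∈ C′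
    C′∋ x∈ y∈
      with p , p∈ , refl ← ∈-map⁻ proj₁ x∈ | q , q∈ , refl ← ∈-map⁻ proj₂ y∈
      = ∈-filter⁺ (λ e → ¬? (e Fin.≟ c))
          (C∋ (proj₁ (F⊆ (F₁⊆F p∈))) (proj₂ (F⊆ (F₂⊆F q∈))))
          (colour-avoided mono (F₁⊆F p∈) (F₂⊆F q∈)
            -- The two halves of a list without repetition are disjoint, so the two tips are
            -- different cells.
            (Unique-++⁻-disjoint F₁ (subst Unique (sym (take++drop≡id h F)) F!) p∈ q∈))

    inhabited : ∀ {xs : List Cell} → 1 < length xs → ∃ (_∈ xs)
    inhabited {x ∷ _} _ = x , here refl

    -- Removing `c` shortens `C` only if `c` occurs there; any cell of `F` shows that it does. The
    -- double negation is the complement of the filtering predicate.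
    c∈C : Any.Any (λ e → ¬ ¬ e ≡ c) C
    c∈C with p , p∈ ← inhabited 1<f
      = Any.map (λ { refl ≢c → ≢c (proj₂ (mono p∈)) }) (uncurry C∋ (F⊆ p∈))

  order-bound : n ≤ (4 * k) ^ (2 ^ k)
  order-bound = subst (λ m → n ≤ m ^ (2 ^ k)) (*-identityʳ (4 * k)) (≮⇒≥
    (shrink k 1 (allFin n) (allFin n) (allFin k) (Unique.allFin⁺ n) (Unique.allFin⁺ n)
      (λ _ _ → ∈-allFin _) (≤-reflexive (length-tabulate {n = k} (λ i → i))) n≤ n≤))
    where
    n≤ : n ≤ length (allFin n) * 1
    n≤ = ≤-reflexive (sym (trans (*-identityʳ _) (length-tabulate {n = n} (λ i → i))))

-- From covers by cylinder intersections to colourings.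

-- The tip that differs from the centre in coordinate `i` lies in the cylinder that ignores this
-- coordinate, which therefore contains the centre.
star-centre : ∀ {n} {S : Cube n} → IsCylinderIntersection S → ∀ {x x′ y y′ z z′} →
  S (x′ ∷ᵥ y ∷ᵥ z ∷ᵥ []ᵥ) ≡ true → S (x ∷ᵥ y′ ∷ᵥ z ∷ᵥ []ᵥ) ≡ true →
  S (x ∷ᵥ y ∷ᵥ z′ ∷ᵥ []ᵥ) ≡ true → S (x ∷ᵥ y ∷ᵥ z ∷ᵥ []ᵥ) ≡ true
star-centre {S = S} (T , cylinder , S≡T) {x} {x′} {y} {y′} {z} {z′} S₀ S₁ S₂ =
  trans (S≡T _) (cong₂ _∧_ (cylinder zero _ x (proj₁ (components S₀)))
    (cong₂ _∧_ (cylinder (suc zero) _ y (proj₁ (proj₂ (components S₁))))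
               (cylinder (suc (suc zero)) _ z (proj₂ (proj₂ (components S₂))))))
  where
  components : ∀ {p} → S p ≡ true →
    T zero p ≡ true × T (suc zero) p ≡ true × T (suc (suc zero)) p ≡ true
  components {p} Sp = ∧-conicalˡ _ _ T₀₁₂ , ∧-conicalˡ _ _ T₁₂ , ∧-conicalʳ (T (suc zero) p) _ T₁₂
    where
    T₀₁₂ = trans (sym (S≡T p)) Sp
    T₁₂ = ∧-conicalʳ (T zero p) _ T₀₁₂

IsPermutation-unique : ∀ {n} (f : Cube n) → IsPermutation f → ∀ i x {a b} →
  f (x [ i ]≔ a) ≡ true → f (x [ i ]≔ b) ≡ true → a ≡ b
IsPermutation-unique f perm i x fa fb with _ , _ , unique ← perm i x = trans (sym (unique fa)) (unique fb)

cover-bound : ∀ {n k} {f : Cube n} → IsPermutation f → IsCoveredBy f k → n ≤ (4 * k) ^ (2 ^ k)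
cover-bound {n} {k} {f} perm (S , S-cyl , S⊆f , S-covers) =
  order-bound symbol colour row-injective column-injective corner-free
  where
  symbol : Fin n → Fin n → Fin n
  -- The third entry `x` is only a filler, which the update overwrites.
  symbol x y = proj₁ (perm (suc (suc zero)) (x ∷ᵥ y ∷ᵥ x ∷ᵥ []ᵥ))

  point : Fin n → Fin n → Point n
  point x y = x ∷ᵥ y ∷ᵥ symbol x y ∷ᵥ []ᵥ

  f-point : ∀ x y → f (point x y) ≡ true
  f-point x y = proj₁ (proj₂ (perm (suc (suc zero)) (x ∷ᵥ y ∷ᵥ x ∷ᵥ []ᵥ)))

  colour : Fin n → Fin n → Fin k
  colour x y = proj₁ (S-covers (point x y) (f-point x y))

  S-point : ∀ x y → S (colour x y) (point x y) ≡ true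
  S-point x y = proj₂ (S-covers (point x y) (f-point x y))

  row-injective : ∀ {x y y′} → symbol x y ≡ symbol x y′ → y ≡ y′
  row-injective {x} {y} {y′} eq = IsPermutation-unique f perm (suc zero) (point x y)
    (f-point x y) (subst (λ z → f (x ∷ᵥ y′ ∷ᵥ z ∷ᵥ []ᵥ) ≡ true) (sym eq) (f-point x y′))

  column-injective : ∀ {x x′ y} → symbol x y ≡ symbol x′ y → x ≡ x′
  column-injective {x} {x′} {y} eq = IsPermutation-unique f perm zero (point x y)
    (f-point x y) (subst (λ z → f (x′ ∷ᵥ y ∷ᵥ z ∷ᵥ []ᵥ) ≡ true) (sym eq) (f-point x′ y))

  -- The star has centre `(x, y′, symbol x y)`, and all three tips lie in the same member of the
  -- cover. Hence the centre lies in `f`, on a line in direction 1 with `point x y`.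
  corner-free : ∀ {x y x′ y′} → symbol x y ≡ symbol x′ y′ →
    colour x y ≡ colour x′ y′ → colour x y′ ≡ colour x y → y ≡ y′
  corner-free {x} {y} {x′} {y′} s≡ c≡ c≡′ =
    IsPermutation-unique f perm (suc zero) (point x y) (f-point x y)
      (S⊆f (colour x y) _ (star-centre (S-cyl (colour x y)) tip₀ (S-point x y) tip₂))
    where
    tip₀ : S (colour x y) (x′ ∷ᵥ y′ ∷ᵥ symbol x y ∷ᵥ []ᵥ) ≡ true
    tip₀ = subst₂ (λ c z → S c (x′ ∷ᵥ y′ ∷ᵥ z ∷ᵥ []ᵥ) ≡ true) (sym c≡) (sym s≡) (S-point x′ y′)

    tip₂ : S (colour x y) (point x y′) ≡ true
    tip₂ = subst (λ c → S c (point x y′) ≡ true) c≡′ (S-point x y′)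

-- Iterated logarithms of the bound, in natural numbers.

2^-cancel-< : ∀ {m n} → 2 ^ m < 2 ^ n → m < n
2^-cancel-< 2^m<2^n = ≰⇒> λ n≤m → <⇒≱ 2^m<2^n (^-monoʳ-≤ 2 n≤m)

n<2^n : ∀ n → n < 2 ^ n
n<2^n zero    = z<s
n<2^n (suc n) = +-mono-≤ (m^n>0 2 n) (≤-trans (n<2^n n) (m≤m+n (2 ^ n) 0))

-- A and d stand for integers just below log log n and just above log log log n.
exponent-bound : ∀ {n k} A d → n ≤ (4 * k) ^ (2 ^ k) → 2 ^ (2 ^ A) < n →
  n < 2 ^ (2 ^ (2 ^ d)) → A ≤ k + d
exponent-bound {n} {k} A d n≤ n> n< with A ≤? k
... | yes A≤k = m≤n⇒m≤n+o d A≤k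
... | no  A≰k = <⇒≤ (subst (A <_) (+-comm d k) (2^-cancel-< (begin-strict
  2 ^ A             <⟨ 2^-cancel-< 2^2^A< ⟩
  -- The two strict inequalities in `k < A < 2 ^ d` absorb the summand 2.
  (2 + k) * 2 ^ k   ≤⟨ *-monoˡ-≤ (2 ^ k) (≤-trans (s≤s k<A) A<2^d) ⟩
  2 ^ d * 2 ^ k     ≡⟨ ^-distribˡ-+-* 2 d k ⟨
  2 ^ (d + k)       ∎)))
  where
  open ≤-Reasoning

  k<A : k < A
  k<A = ≰⇒> A≰k

  A<2^d : A < 2 ^ d
  A<2^d = 2^-cancel-< (2^-cancel-< (<-trans n> n<))

  2^2^A< : 2 ^ (2 ^ A) < 2 ^ ((2 + k) * 2 ^ k)
  2^2^A< = begin-strict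
    2 ^ (2 ^ A)               <⟨ n> ⟩
    n                         ≤⟨ n≤ ⟩
    (4 * k) ^ (2 ^ k)         ≤⟨ ^-monoˡ-≤ (2 ^ k) (*-monoʳ-≤ 4 (<⇒≤ (n<2^n k))) ⟩
    (4 * 2 ^ k) ^ (2 ^ k)     ≡⟨ cong (_^ (2 ^ k)) (sym (^-distribˡ-+-* 2 2 k)) ⟩
    (2 ^ (2 + k)) ^ (2 ^ k)   ≡⟨ ^-*-assoc 2 (2 + k) (2 ^ k) ⟩
    2 ^ ((2 + k) * 2 ^ k)     ∎

-- Natural numbers and powers inside the rationals.

ℚ-≤⇒≯ : ∀ {p q} → p ℚ.≤ q → ¬ q ℚ.< p
ℚ-≤⇒≯ p≤q q<p = ℚ.<-irrefl refl (ℚ.≤-<-trans p≤q q<p)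

ι : ℕ → ℚ
ι n = ℤ.+ n / 1

-- Division by 1 normalises through a gcd that does not reduce for a variable `n`; the explicit form
-- exposes numerator and denominator.
ι≡mkℚ : ∀ n → ι n ≡ mkℚ (ℤ.+ n) 0 (Coprime.sym (Coprime.1-coprimeTo n))
ι≡mkℚ n = ℚ.normalize-coprime (Coprime.sym (Coprime.1-coprimeTo n))

↥-ι : ∀ n → ↥ ι n ≡ ℤ.+ n
↥-ι n = cong ↥_ (ι≡mkℚ n)

↧-ι : ∀ n → ↧ ι n ≡ ℤ.+ 1
↧-ι n = cong ↧_ (ι≡mkℚ n)

ι≤⇒ : ∀ n q → ι n ℚ.≤ q → ℤ.+ n ℤ.* ↧ q ℤ.≤ ↥ q
ι≤⇒ n q n≤q = subst₂ ℤ._≤_ (cong (ℤ._* ↧ q) (↥-ι n))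
  (trans (cong (↥ q ℤ.*_) (↧-ι n)) (ℤ.*-identityʳ (↥ q))) (ℚ.drop-*≤* n≤q)

⇒ι≤ : ∀ n q → ℤ.+ n ℤ.* ↧ q ℤ.≤ ↥ q → ι n ℚ.≤ q
⇒ι≤ n q n≤q = ℚ.*≤* (subst₂ ℤ._≤_ (cong (ℤ._* ↧ q) (sym (↥-ι n)))
  (sym (trans (cong (↥ q ℤ.*_) (↧-ι n)) (ℤ.*-identityʳ (↥ q)))) n≤q)

≤ι⇒ : ∀ n q → q ℚ.≤ ι n → ↥ q ℤ.≤ ℤ.+ n ℤ.* ↧ q
≤ι⇒ n q q≤n = subst₂ ℤ._≤_ (trans (cong (↥ q ℤ.*_) (↧-ι n)) (ℤ.*-identityʳ (↥ q)))
  (cong (ℤ._* ↧ q) (↥-ι n)) (ℚ.drop-*≤* q≤n)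

⇒≤ι : ∀ n q → ↥ q ℤ.≤ ℤ.+ n ℤ.* ↧ q → q ℚ.≤ ι n
⇒≤ι n q q≤n = ℚ.*≤* (subst₂ ℤ._≤_ (sym (trans (cong (↥ q ℤ.*_) (↧-ι n)) (ℤ.*-identityʳ (↥ q))))
  (cong (ℤ._* ↧ q) (sym (↥-ι n))) q≤n)

ι-mono-≤ : ∀ {m n} → m ≤ n → ι m ℚ.≤ ι n
ι-mono-≤ {m} {n} m≤n = ⇒ι≤ m (ι n)
  (subst₂ ℤ._≤_ (sym (trans (cong (ℤ.+ m ℤ.*_) (↧-ι n)) (ℤ.*-identityʳ (ℤ.+ m)))) (sym (↥-ι n)) (ℤ.+≤+ m≤n))

ι-cancel-< : ∀ {m n} → ι m ℚ.< ι n → m < n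
ι-cancel-< {m} {n} m<n = ≰⇒> λ n≤m → ℚ-≤⇒≯ (ι-mono-≤ n≤m) m<n

ι-+ : ∀ m n → ι (m + n) ≡ ι m ℚ.+ ι n
ι-+ m n = sym (trans (cong₂ ℚ._+_ (ι≡mkℚ m) (ι≡mkℚ n))
  (cong (_/ 1) (cong₂ ℤ._+_ (ℤ.*-identityʳ (ℤ.+ m)) (ℤ.*-identityʳ (ℤ.+ n)))))

ι-* : ∀ m n → ι (m * n) ≡ ι m ℚ.* ι n
ι-* m n = sym (trans (cong₂ ℚ._*_ (ι≡mkℚ m) (ι≡mkℚ n)) (cong (_/ 1) (sym (ℤ.pos-* m n))))

ι-^ : ∀ m n → ι (m ^ n) ≡ ι m ℚ^ n
ι-^ m zero    = refl
ι-^ m (suc n) = trans (ι-* m (m ^ n)) (cong (ι m ℚ.*_) (ι-^ m n))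

-- Nonnegativity is proved alongside, since multiplying inequalities in the inductive step requires
-- it.
ℚ^-mono-≤ : ∀ {p q} n → 0ℚ ℚ.≤ p → p ℚ.≤ q → 0ℚ ℚ.≤ p ℚ^ n × p ℚ^ n ℚ.≤ q ℚ^ n
ℚ^-mono-≤ zero    0≤p p≤q = ℚ.*≤* (ℤ.+≤+ z≤n) , ℚ.≤-refl
ℚ^-mono-≤ {p} {q} (suc n) 0≤p p≤q with 0≤p^n , p^n≤q^n ← ℚ^-mono-≤ n 0≤p p≤q =
  subst (ℚ._≤ p ℚ.* p ℚ^ n) (ℚ.*-zeroʳ p) (ℚ.*-monoˡ-≤-nonNeg p {{ℚ.nonNegative 0≤p}} 0≤p^n) ,
  ℚ.≤-trans (ℚ.*-monoˡ-≤-nonNeg p {{ℚ.nonNegative 0≤p}} p^n≤q^n)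
            (ℚ.*-monoʳ-≤-nonNeg (q ℚ^ n) {{ℚ.nonNegative (ℚ.≤-trans 0≤p^n p^n≤q^n)}} p≤q)

≤2^ : ∀ {m i} → ℤ.+ m ℤ.≤ i → ι (2 ^ m) ℚ.≤ 2^ i
≤2^ {m} {ℤ.+ n} (ℤ.+≤+ m≤n) = subst (ι (2 ^ m) ℚ.≤_) (ι-^ 2 n) (ι-mono-≤ (^-monoʳ-≤ 2 m≤n))

2^≤ : ∀ {m i} → i ℤ.≤ ℤ.+ m → 2^ i ℚ.≤ ι (2 ^ m)
2^≤ {m} {ℤ.+ n} (ℤ.+≤+ n≤m) = subst (ℚ._≤ ι (2 ^ m)) (ι-^ 2 n) (ι-mono-≤ (^-monoʳ-≤ 2 n≤m))
-- For a negative exponent, the power of one half is at most a power of 1, hence at most `2 ^ m`.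
2^≤ {m} {ℤ.-[1+ n ]} _ = ℚ.≤-trans
  (proj₂ (ℚ^-mono-≤ {½} {ι 1} (suc n) (ℚ.*≤* (ℤ.+≤+ z≤n)) (ℚ.*≤* (ℤ.+≤+ (s≤s z≤n)))))
  (ℚ.≤-trans (ℚ.≤-reflexive (trans (sym (ι-^ 1 (suc n))) (cong ι (^-zeroˡ (suc n))))) (ι-mono-≤ (m^n>0 2 m)))

0≤ι : ∀ n → 0ℚ ℚ.≤ ι n
0≤ι n = ι-mono-≤ {0} {n} z≤n

ι2^-^ : ∀ m d → ι (2 ^ m) ℚ^ d ≡ ι (2 ^ (m * d))
ι2^-^ m d = trans (sym (ι-^ (2 ^ m) d)) (cong ι (^-*-assoc 2 m d))

-- Integer bounds extracted from the logarithm cuts.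

-- Write `q` as a/b. If `r` were at most `2 ^ m`, its b-th power would be at most `2 ^ (m * b)`,
-- hence at most 2 to the a, against the definition of the cut. As `2 ^ m` is again a natural
-- number, the lemma can be iterated.
log₂-lower : ∀ x m {q} → lower (log₂ x) q → ι m ℚ.≤ q → ∃[ r ] lower x r × ι (2 ^ m) ℚ.< r
log₂-lower x m {q} (r , 0<r , x>r , 2^<r^) m≤q = r , x>r , ℚ.≰⇒> λ r≤2^m → ℚ-≤⇒≯ (begin
  r ℚ^ ↧ₙ q              ≤⟨ proj₂ (ℚ^-mono-≤ (↧ₙ q) (ℚ.<⇒≤ 0<r) r≤2^m) ⟩
  ι (2 ^ m) ℚ^ ↧ₙ q      ≡⟨ ι2^-^ m (↧ₙ q) ⟩
  ι (2 ^ (m * ↧ₙ q))     ≤⟨ ≤2^ (subst (ℤ._≤ ↥ q) (sym (ℤ.pos-* m (↧ₙ q))) (ι≤⇒ m q m≤q)) ⟩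
  2^ (↥ q)               ∎) 2^<r^
  where open ℚ.≤-Reasoning

log₂-upper : ∀ x m {q} → upper (log₂ x) q → q ℚ.≤ ι m → ∃[ r ] upper x r × r ℚ.< ι (2 ^ m)
log₂-upper x m {q} (r , 0<r , x<r , r^<2^) q≤m = r , x<r , ℚ.≰⇒> λ 2^m≤r → ℚ-≤⇒≯ (begin
  2^ (↥ q)               ≤⟨ 2^≤ (subst (↥ q ℤ.≤_) (sym (ℤ.pos-* m (↧ₙ q))) (≤ι⇒ m q q≤m)) ⟩
  ι (2 ^ (m * ↧ₙ q))     ≡⟨ ι2^-^ m (↧ₙ q) ⟨
  ι (2 ^ m) ℚ^ ↧ₙ q      ≤⟨ proj₂ (ℚ^-mono-≤ (↧ₙ q) (0≤ι (2 ^ m)) 2^m≤r) ⟩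
  r ℚ^ ↧ₙ q              ∎) r^<2^
  where open ℚ.≤-Reasoning

log₂log₂-lower : ∀ {n} m {q} → lower (log₂ (log₂ (fromℕ n))) q → ι m ℚ.≤ q → 2 ^ (2 ^ m) < n
log₂log₂-lower {n} m loglog>q m≤q =
  let r , log>r , 2^m<r = log₂-lower (log₂ (fromℕ n)) m loglog>q m≤q
      _ , n>s , 2^2^m<s = log₂-lower (fromℕ n) (2 ^ m) {r} log>r (ℚ.<⇒≤ 2^m<r)
  in ι-cancel-< {2 ^ (2 ^ m)} {n} (ℚ.<-trans 2^2^m<s n>s)

log₂log₂log₂-upper : ∀ {n} m {q} → upper (log₂ (log₂ (log₂ (fromℕ n)))) q → q ℚ.≤ ι m →
  n < 2 ^ (2 ^ (2 ^ m))
log₂log₂log₂-upper {n} m logloglog<q q≤m =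
  let r , loglog<r , r<2^m  = log₂-upper (log₂ (log₂ (fromℕ n))) m logloglog<q q≤m
      s , log<s , s<2^2^m   = log₂-upper (log₂ (fromℕ n)) (2 ^ m) {r} loglog<r (ℚ.<⇒≤ r<2^m)
      _ , n<t , t<2^2^2^m   = log₂-upper (fromℕ n) (2 ^ (2 ^ m)) {s} log<s (ℚ.<⇒≤ s<2^2^m)
  in ι-cancel-< {n} {2 ^ (2 ^ (2 ^ m))} (ℚ.<-trans n<t t<2^2^2^m)

m<[1+m/n]*n : ∀ m n .{{_ : NonZero n}} → m < suc (m ℕ./ n) * n
m<[1+m/n]*n m n = subst (_< suc (m ℕ./ n) * n) (sym (m≡m%n+[m/n]*n m n))
  (+-monoˡ-< (m ℕ./ n * n) (m%n<n m n))

floor-bounds : ∀ q → 0ℚ ℚ.≤ q → ∃[ m ] ι m ℚ.≤ q × q ℚ.≤ ι (suc m)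
floor-bounds q@(mkℚ (ℤ.+ p) d-1 _) 0≤q = m
  , ⇒ι≤ m q (subst (ℤ._≤ ℤ.+ p) (ℤ.pos-* m d) (ℤ.+≤+ (m/n*n≤m p d)))
  , ⇒≤ι (suc m) q (subst (ℤ.+ p ℤ.≤_) (ℤ.pos-* (suc m) d) (ℤ.+≤+ (<⇒≤ (m<[1+m/n]*n p d))))
  where
  d = suc d-1
  m = p ℕ./ d
floor-bounds (mkℚ ℤ.-[1+ _ ] _ _) (ℚ.*≤* ())

-- The final estimate on cuts.

fromℚ-isReal : ∀ p → IsReal (fromℚ p)
fromℚ-isReal p = record
  { lower-inhabited = p ℚ.- 1ℚ , subst (p ℚ.- 1ℚ ℚ.<_) (ℚ.+-identityʳ p) (ℚ.+-monoʳ-< p (ℚ.*<* ℤ.-<+))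
  ; upper-inhabited = p ℚ.+ 1ℚ , subst (ℚ._< p ℚ.+ 1ℚ) (ℚ.+-identityʳ p) (ℚ.+-monoʳ-< p (ℚ.*<* (ℤ.+<+ z<s)))
  ; lower-open      = ℚ.<-dense
  ; lower-closed    = ℚ.<-trans
  ; upper-open      = λ p<r → case ℚ.<-dense p<r of λ (q , p<q , q<r) → q , q<r , p<q
  ; upper-closed    = λ q<r p<q → ℚ.<-trans p<q q<r
  ; disjoint        = λ (q<p , p<q) → ℚ.<-asym q<p p<q
  ; located         = located
  }
  where
  located : ∀ {q r} → q ℚ.< r → q ℚ.< p ⊎ p ℚ.< r
  located {q} q<r with q ℚ.<? p
  ... | yes q<p = inj₁ q<p
  ... | no  q≮p = inj₂ (ℚ.≤-<-trans (ℚ.≮⇒≥ q≮p) q<r)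

p≤q+r⇒p-r≤q : ∀ {p q} r → p ℚ.≤ q ℚ.+ r → p ℚ.- r ℚ.≤ q
p≤q+r⇒p-r≤q {p} {q} r p≤q+r = subst (p ℚ.- r ℚ.≤_)
  (trans (ℚ.+-assoc q r (ℚ.- r)) (trans (cong (q ℚ.+_) (ℚ.+-inverseʳ r)) (ℚ.+-identityʳ q)))
  (ℚ.+-monoˡ-≤ (ℚ.- r) p≤q+r)

-- Unfolding the cuts gives `a` below log log n, `c` above 3 and `d` above log log log n, with
-- `c * d < b` and `q < a - b`. So it suffices that `a` is at most `k` plus `b`, and `b` is at least
-- three times `d`.
lower-bound : ∀ n k → 16 ≤ n → n ≤ (4 * k) ^ (2 ^ k) →
  fromℕ k ≥ᶜ log₂ (log₂ (fromℕ n)) -ᶜ fromℕ 3 *ᶜ log₂ (log₂ (log₂ (fromℕ n)))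
lower-bound n k 16≤n n≤ q
  (a , b , a<loglog , (_ , c , _ , d , (_ , 3<c , _ , logloglog<d) , _ , _ , _ , cd<b) , q<a-b) =
  ℚ.<-≤-trans q<a-b (p≤q+r⇒p-r≤q b a≤k+b)
  where
  open ℚ.≤-Reasoning

  1≤d : ι 1 ℚ.≤ d
  -- The threshold 16 is `2 ^ (2 ^ (2 ^ 1))`, so log log log n is at least 1.
  1≤d = ℚ.≮⇒≥ λ d<1 → <⇒≱ (log₂log₂log₂-upper 1 logloglog<d (ℚ.<⇒≤ d<1)) 16≤n

  0<d : 0ℚ ℚ.< d
  0<d = ℚ.<-≤-trans (ℚ.*<* (ℤ.+<+ z<s)) 1≤d

  3d≤b : d ℚ.+ (d ℚ.+ d) ℚ.≤ b
  3d≤b = begin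
    d ℚ.+ (d ℚ.+ d)   ≡⟨ sym (trans (ℚ.*-distribʳ-+ d 1ℚ (1ℚ ℚ.+ 1ℚ)) (cong₂ ℚ._+_ (ℚ.*-identityˡ d)
                          (trans (ℚ.*-distribʳ-+ d 1ℚ 1ℚ) (cong₂ ℚ._+_ (ℚ.*-identityˡ d) (ℚ.*-identityˡ d))))) ⟩
    ι 3 ℚ.* d         ≤⟨ ℚ.*-monoʳ-≤-nonNeg d {{ℚ.nonNegative (ℚ.<⇒≤ 0<d)}} (ℚ.<⇒≤ 3<c) ⟩
    c ℚ.* d           ≤⟨ ℚ.<⇒≤ cd<b ⟩
    b                 ∎

  0≤b : 0ℚ ℚ.≤ b
  0≤b = ℚ.≤-trans (ℚ.+-mono-≤ (ℚ.<⇒≤ 0<d) (ℚ.+-mono-≤ (ℚ.<⇒≤ 0<d) (ℚ.<⇒≤ 0<d))) 3d≤b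

  1+A≤ : ∀ A D → ι A ℚ.≤ a → d ℚ.≤ ι (suc D) → suc A ≤ k + (D + 2)
  1+A≤ A D A≤a d≤1+D = subst (suc A ≤_)
    (solve 2 (λ k D → con 1 :+ (k :+ (con 1 :+ D)) := k :+ (D :+ con 2)) refl k D)
    (s≤s (exponent-bound {k = k} A (suc D) n≤
      (log₂log₂-lower A a<loglog A≤a) (log₂log₂log₂-upper (suc D) logloglog<d d≤1+D)))
    where open +-*-Solver

  a≤k+b : a ℚ.≤ ι k ℚ.+ b
  a≤k+b with 0ℚ ℚ.≤? a
  -- A negative `a` has no natural integer part, but is below `k` plus `b` anyway.
  ... | no  0≰a = ℚ.≤-trans (ℚ.<⇒≤ (ℚ.≰⇒> 0≰a)) (ℚ.+-mono-≤ (0≤ι k) 0≤b)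
  ... | yes 0≤a =
    let A , A≤a , a≤1+A = floor-bounds a 0≤a
        D , D≤d , d≤1+D = floor-bounds d (ℚ.<⇒≤ 0<d)
    in begin
    a                               ≤⟨ a≤1+A ⟩
    ι (suc A)                       ≤⟨ ι-mono-≤ (1+A≤ A D A≤a d≤1+D) ⟩
    ι (k + (D + 2))                 ≡⟨ trans (ι-+ k (D + 2)) (cong (ι k ℚ.+_) (ι-+ D 2)) ⟩
    -- This accounts for the constant 3: one `d` covers its integer part `D`, and two more cover the
    -- two units lost in rounding `a` down and `d` up.
    ι k ℚ.+ (ι D ℚ.+ (ι 1 ℚ.+ ι 1)) ≤⟨ ℚ.+-monoʳ-≤ (ι k) (ℚ.+-mono-≤ D≤d (ℚ.+-mono-≤ 1≤d 1≤d)) ⟩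
    ι k ℚ.+ (d ℚ.+ (d ℚ.+ d))       ≤⟨ ℚ.+-monoʳ-≤ (ι k) 3d≤b ⟩
    ι k ℚ.+ b                       ∎

theorem36 : ∃[ C ] IsReal C × fromℕ 0 <ᶜ C ×
    (∃[ n₀ ] (∀ n → n₀ ≤ n → ∀ k → χ₃-min n k →
    fromℕ k ≥ᶜ log₂ (log₂ (fromℕ n)) -ᶜ C *ᶜ log₂ (log₂ (log₂ (fromℕ n)))))
theorem36 = fromℕ 3 , fromℚ-isReal (ι 3) , (1ℚ , ℚ.*<* (ℤ.+<+ z<s) , ℚ.*<* (ℤ.+<+ (s≤s (s≤s z≤n))))
  , 16 , λ n 16≤n k ((f , perm , cover , _) , _) → lower-bound n k 16≤n (cover-bound perm cover)
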